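{- The category $\mathsf{BA}$ of Boolean algebras (with Boolean homomorphisms) and the category $\mathsf{C3DP}$ of c3dp-algebras (with homomorphisms of algebras in the signature $\{\wedge,\vee,\neg,D,0,c,1\}$) are equivalent.
   Context: A dp-algebra (double p-algebra) is an algebra $(A;\wedge,\vee,\neg,D,0,1)$ of type $(2,2,1,1,0,0)$ such that $(A;\wedge,\vee,0,1)$ is a bounded distributive lattice; for every $a\in A$, $\neg a$ is the greatest $b\in A$ with $a\wedge b=0$; and for every $a\in A$, $Da$ is the smallest $b\in A$ with $a\vee b=1$. It is regular if $a\wedge Da\le b\vee\neg b$ for all $a,b\in A$. A three-valued dp-algebra is a regular dp-algebra satisfying $\neg x\vee\neg\neg x=1$ and $Dx\wedge DDx=0$. A c3dp-algebra (centred three-valued dp-algebra) is an algebra $(A;\wedge,\vee,\neg,D,0,c,1)$ such that $(A;\wedge,\vee,\neg,D,0,1)$ is a three-valued dp-algebra and the constant $c$ satisfies $\neg c=0$ and $Dc=1$. -}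

module Defs where

open import Level using (Level; _⊔_; suc)
open import Data.Product using (_×_)
open import Function.Base using (id; _∘_; flip)
open import Relation.Binary.Core using (Rel)
open import Relation.Binary.Structures using (IsEquivalence)
import Relation.Binary.Construct.NaturalOrder.Left as NaturalOrder
open import Algebra.Core using (Op₁; Op₂)
import Algebra.Definitions as AlgebraDefinitions
import Algebra.Lattice.Structures as LatticeStructures
open import Algebra.Lattice.Bundles using (DistributiveLattice; BooleanAlgebra)
open import Algebra.Lattice.Morphism.Structures using (IsLatticeHomomorphism)
import Algebra.Lattice.Morphism.Construct.Identity as LatticeId
import Algebra.Lattice.Morphism.Construct.Composition as LatticeComp
import Algebra.Morphism.Definitions as MorphismDefinitions

-- Sets are setoids throughout: algebras carry their own equality, homomorphisms
-- respect it, and parallel homomorphisms are identified when pointwise equal.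
-- Objects of a category are compared only up to isomorphism.

record Category (o h e : Level) : Set (suc (o ⊔ h ⊔ e)) where
  infix  4 _≈_ _⇒_
  infixr 9 _∘ᶜ_
  field
    Obj       : Set o
    _⇒_       : Rel Obj h
    _≈_       : ∀ {X Y} → Rel (X ⇒ Y) e
    idᶜ       : ∀ {X} → X ⇒ X
    _∘ᶜ_      : ∀ {X Y Z} → Y ⇒ Z → X ⇒ Y → X ⇒ Z
    equiv     : ∀ {X Y} → IsEquivalence (_≈_ {X} {Y})
    ∘-resp-≈  : ∀ {X Y Z} {f f′ : Y ⇒ Z} {g g′ : X ⇒ Y} →
                f ≈ f′ → g ≈ g′ → f ∘ᶜ g ≈ f′ ∘ᶜ g′
    identityˡ : ∀ {X Y} {f : X ⇒ Y} → idᶜ ∘ᶜ f ≈ f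
    identityʳ : ∀ {X Y} {f : X ⇒ Y} → f ∘ᶜ idᶜ ≈ f
    assoc     : ∀ {W X Y Z} {f : Y ⇒ Z} {g : X ⇒ Y} {k : W ⇒ X} →
                (f ∘ᶜ g) ∘ᶜ k ≈ f ∘ᶜ (g ∘ᶜ k)

private
  variable
    o h e o′ h′ e′ o″ h″ e″ : Level

record Functor (C : Category o h e) (D : Category o′ h′ e′)
               : Set (o ⊔ h ⊔ e ⊔ o′ ⊔ h′ ⊔ e′) where
  private
    module C = Category C
    module D = Category D
  field
    F₀           : C.Obj → D.Obj
    F₁           : ∀ {X Y} → X C.⇒ Y → F₀ X D.⇒ F₀ Y
    F-resp-≈     : ∀ {X Y} {f g : X C.⇒ Y} → f C.≈ g → F₁ f D.≈ F₁ g
    identity     : ∀ {X} → F₁ (C.idᶜ {X}) D.≈ D.idᶜ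
    homomorphism : ∀ {X Y Z} {f : Y C.⇒ Z} {g : X C.⇒ Y} →
                   F₁ (f C.∘ᶜ g) D.≈ F₁ f D.∘ᶜ F₁ g

idF : {C : Category o h e} → Functor C C
idF {C = C} = record
  { F₀           = id
  ; F₁           = id
  ; F-resp-≈     = id
  ; identity     = IsEquivalence.refl equiv
  ; homomorphism = IsEquivalence.refl equiv
  }
  where open Category C

infixr 9 _∘F_

_∘F_ : {C : Category o h e} {D : Category o′ h′ e′} {E : Category o″ h″ e″} →
       Functor D E → Functor C D → Functor C E
_∘F_ {E = E} G F = record
  { F₀           = G.F₀ ∘ F.F₀
  ; F₁           = G.F₁ ∘ F.F₁
  ; F-resp-≈     = G.F-resp-≈ ∘ F.F-resp-≈
  ; identity     = IsEquivalence.trans equiv (G.F-resp-≈ F.identity) G.identity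
  ; homomorphism = IsEquivalence.trans equiv (G.F-resp-≈ F.homomorphism) G.homomorphism
  }
  where
  open Category E
  module F = Functor F
  module G = Functor G

infix 4 _≅_

record _≅_ {C : Category o h e} {D : Category o′ h′ e′}
           (F G : Functor C D) : Set (o ⊔ h ⊔ e ⊔ o′ ⊔ h′ ⊔ e′) where
  private
    module C = Category C
    module F = Functor F
    module G = Functor G
  open Category D
  field
    to      : ∀ X → F.F₀ X ⇒ G.F₀ X
    from    : ∀ X → G.F₀ X ⇒ F.F₀ X
    natural : ∀ {X Y} (f : X C.⇒ Y) → to Y ∘ᶜ F.F₁ f ≈ G.F₁ f ∘ᶜ to X
    to∘from : ∀ X → to X ∘ᶜ from X ≈ idᶜ
    from∘to : ∀ X → from X ∘ᶜ to X ≈ idᶜ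

record Equivalence (C : Category o h e) (D : Category o′ h′ e′)
                   : Set (o ⊔ h ⊔ e ⊔ o′ ⊔ h′ ⊔ e′) where
  field
    F    : Functor C D
    G    : Functor D C
    G∘F≅ : G ∘F F ≅ idF
    F∘G≅ : F ∘F G ≅ idF

module _ {a ℓ} {A : Set a} (_≈_ : Rel A ℓ) where

  open AlgebraDefinitions _≈_
  open LatticeStructures _≈_

  record IsBoundedDistributiveLattice (∨ ∧ : Op₂ A) (⊤ ⊥ : A) : Set (a ⊔ ℓ) where
    field
      isDistributiveLattice : IsDistributiveLattice ∨ ∧
      ∨-identity            : Identity ⊥ ∨
      ∧-identity            : Identity ⊤ ∧

    open IsDistributiveLattice isDistributiveLattice public

  Greatest : Rel A ℓ → (A → Set ℓ) → A → Set (a ⊔ ℓ)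
  Greatest _≤_ P x = P x × (∀ y → P y → y ≤ x)

  -- _≤_ unfolds to x ≤ y = x ≈ (x ∧ y).  The two congruence fields follow from the
  -- last two; they only record that ¬ and D are operations on the setoid.
  record IsDPAlgebra (_∨_ _∧_ : Op₂ A) (¬_ D : Op₁ A) (⊤ ⊥ : A) : Set (a ⊔ ℓ) where
    open NaturalOrder _≈_ _∧_ using (_≤_)
    field
      isBoundedDistributiveLattice : IsBoundedDistributiveLattice _∨_ _∧_ ⊤ ⊥
      ¬-cong     : Congruent₁ ¬_
      D-cong     : Congruent₁ D
      ¬-greatest : ∀ x → Greatest _≤_ (λ y → (x ∧ y) ≈ ⊥) (¬ x)
      D-least    : ∀ x → Greatest (flip _≤_) (λ y → (x ∨ y) ≈ ⊤) (D x)

    open IsBoundedDistributiveLattice isBoundedDistributiveLattice public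

  record IsRegularDPAlgebra (_∨_ _∧_ : Op₂ A) (¬_ D : Op₁ A) (⊤ ⊥ : A) : Set (a ⊔ ℓ) where
    open NaturalOrder _≈_ _∧_ using (_≤_)
    field
      isDPAlgebra : IsDPAlgebra _∨_ _∧_ ¬_ D ⊤ ⊥
      regular     : ∀ x y → (x ∧ D x) ≤ (y ∨ (¬ y))

    open IsDPAlgebra isDPAlgebra public

  record IsThreeValuedDPAlgebra (_∨_ _∧_ : Op₂ A) (¬_ D : Op₁ A) (⊤ ⊥ : A) : Set (a ⊔ ℓ) where
    field
      isRegularDPAlgebra : IsRegularDPAlgebra _∨_ _∧_ ¬_ D ⊤ ⊥
      ¬-stone            : ∀ x → ((¬ x) ∨ (¬ (¬ x))) ≈ ⊤
      D-stone            : ∀ x → (D x ∧ D (D x)) ≈ ⊥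

    open IsRegularDPAlgebra isRegularDPAlgebra public

  record IsC3DPAlgebra (_∨_ _∧_ : Op₂ A) (¬_ D : Op₁ A) (⊤ ⊥ c : A) : Set (a ⊔ ℓ) where
    field
      isThreeValuedDPAlgebra : IsThreeValuedDPAlgebra _∨_ _∧_ ¬_ D ⊤ ⊥
      ¬-centre               : (¬ c) ≈ ⊥
      D-centre               : D c ≈ ⊤

    open IsThreeValuedDPAlgebra isThreeValuedDPAlgebra public

record C3DPAlgebra (a ℓ : Level) : Set (suc (a ⊔ ℓ)) where
  infix  8 ¬_
  infixr 7 _∧_
  infixr 6 _∨_
  infix  4 _≈_
  field
    Carrier       : Set a
    _≈_           : Rel Carrier ℓ
    _∨_           : Op₂ Carrier
    _∧_           : Op₂ Carrier
    ¬_            : Op₁ Carrier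
    D             : Op₁ Carrier
    ⊤             : Carrier
    ⊥             : Carrier
    c             : Carrier
    isC3DPAlgebra : IsC3DPAlgebra _≈_ _∨_ _∧_ ¬_ D ⊤ ⊥ c

  open IsC3DPAlgebra isC3DPAlgebra public

  distributiveLattice : DistributiveLattice a ℓ
  distributiveLattice = record { isDistributiveLattice = isDistributiveLattice }

  open DistributiveLattice distributiveLattice public
    using (setoid; lattice; rawLattice)

private
  variable
    a ℓ : Level

-- The library's BooleanAlgebra, like C3DPAlgebra, admits the trivial algebra ⊥ ≈ ⊤.

record BooleanHomomorphism (A B : BooleanAlgebra a ℓ) : Set (a ⊔ ℓ) where
  private
    module A = BooleanAlgebra A
    module B = BooleanAlgebra B
  open MorphismDefinitions A.Carrier B.Carrier B._≈_
  field
    ⟦_⟧                   : A.Carrier → B.Carrier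
    isLatticeHomomorphism : IsLatticeHomomorphism A.rawLattice B.rawLattice ⟦_⟧
    ¬-homo                : Homomorphic₁ ⟦_⟧ A.¬_ B.¬_
    ⊤-homo                : Homomorphic₀ ⟦_⟧ A.⊤ B.⊤
    ⊥-homo                : Homomorphic₀ ⟦_⟧ A.⊥ B.⊥

  open IsLatticeHomomorphism isLatticeHomomorphism public

record C3DPHomomorphism (A B : C3DPAlgebra a ℓ) : Set (a ⊔ ℓ) where
  private
    module A = C3DPAlgebra A
    module B = C3DPAlgebra B
  open MorphismDefinitions A.Carrier B.Carrier B._≈_
  field
    ⟦_⟧                   : A.Carrier → B.Carrier
    isLatticeHomomorphism : IsLatticeHomomorphism A.rawLattice B.rawLattice ⟦_⟧
    ¬-homo                : Homomorphic₁ ⟦_⟧ A.¬_ B.¬_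
    D-homo                : Homomorphic₁ ⟦_⟧ A.D B.D
    ⊤-homo                : Homomorphic₀ ⟦_⟧ A.⊤ B.⊤
    ⊥-homo                : Homomorphic₀ ⟦_⟧ A.⊥ B.⊥
    c-homo                : Homomorphic₀ ⟦_⟧ A.c B.c

  open IsLatticeHomomorphism isLatticeHomomorphism public

BA : (a ℓ : Level) → Category (suc (a ⊔ ℓ)) (a ⊔ ℓ) (a ⊔ ℓ)
BA a ℓ = record
  { Obj       = BooleanAlgebra a ℓ
  ; _⇒_       = BooleanHomomorphism
  ; _≈_       = λ {X} {Y} f g → ∀ x → BooleanAlgebra._≈_ Y (⟦ f ⟧ x) (⟦ g ⟧ x)
  ; idᶜ       = λ {X} → identity X
  ; _∘ᶜ_      = compose
  ; equiv     = λ {X} {Y} → record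
    { refl  = λ x → BooleanAlgebra.refl Y
    ; sym   = λ p x → BooleanAlgebra.sym Y (p x)
    ; trans = λ p q x → BooleanAlgebra.trans Y (p x) (q x)
    }
  ; ∘-resp-≈  = λ {X} {Y} {Z} {f} {f′} {g} {g′} p q x →
      BooleanAlgebra.trans Z (⟦⟧-cong f (q x)) (p (⟦ g′ ⟧ x))
  ; identityˡ = λ {X} {Y} x → BooleanAlgebra.refl Y
  ; identityʳ = λ {X} {Y} x → BooleanAlgebra.refl Y
  ; assoc     = λ {W} {X} {Y} {Z} x → BooleanAlgebra.refl Z
  }
  where
  open BooleanHomomorphism

  identity : (X : BooleanAlgebra a ℓ) → BooleanHomomorphism X X
  identity X = record
    { ⟦_⟧                   = id
    ; isLatticeHomomorphism = LatticeId.isLatticeHomomorphism X.rawLattice X.refl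
    ; ¬-homo                = λ x → X.refl
    ; ⊤-homo                = X.refl
    ; ⊥-homo                = X.refl
    }
    where module X = BooleanAlgebra X

  compose : {X Y Z : BooleanAlgebra a ℓ} →
            BooleanHomomorphism Y Z → BooleanHomomorphism X Y → BooleanHomomorphism X Z
  compose {Z = Z} g f = record
    { ⟦_⟧                   = ⟦ g ⟧ ∘ ⟦ f ⟧
    ; isLatticeHomomorphism = LatticeComp.isLatticeHomomorphism Z.trans
                                (isLatticeHomomorphism f) (isLatticeHomomorphism g)
    ; ¬-homo                = λ x → Z.trans (⟦⟧-cong g (¬-homo f x)) (¬-homo g (⟦ f ⟧ x))
    ; ⊤-homo                = Z.trans (⟦⟧-cong g (⊤-homo f)) (⊤-homo g)
    ; ⊥-homo                = Z.trans (⟦⟧-cong g (⊥-homo f)) (⊥-homo g)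
    }
    where module Z = BooleanAlgebra Z

C3DP : (a ℓ : Level) → Category (suc (a ⊔ ℓ)) (a ⊔ ℓ) (a ⊔ ℓ)
C3DP a ℓ = record
  { Obj       = C3DPAlgebra a ℓ
  ; _⇒_       = C3DPHomomorphism
  ; _≈_       = λ {X} {Y} f g → ∀ x → C3DPAlgebra._≈_ Y (⟦ f ⟧ x) (⟦ g ⟧ x)
  ; idᶜ       = λ {X} → identity X
  ; _∘ᶜ_      = compose
  ; equiv     = λ {X} {Y} → record
    { refl  = λ x → C3DPAlgebra.refl Y
    ; sym   = λ p x → C3DPAlgebra.sym Y (p x)
    ; trans = λ p q x → C3DPAlgebra.trans Y (p x) (q x)
    }
  ; ∘-resp-≈  = λ {X} {Y} {Z} {f} {f′} {g} {g′} p q x →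
      C3DPAlgebra.trans Z (⟦⟧-cong f (q x)) (p (⟦ g′ ⟧ x))
  ; identityˡ = λ {X} {Y} x → C3DPAlgebra.refl Y
  ; identityʳ = λ {X} {Y} x → C3DPAlgebra.refl Y
  ; assoc     = λ {W} {X} {Y} {Z} x → C3DPAlgebra.refl Z
  }
  where
  open C3DPHomomorphism

  identity : (X : C3DPAlgebra a ℓ) → C3DPHomomorphism X X
  identity X = record
    { ⟦_⟧                   = id
    ; isLatticeHomomorphism = LatticeId.isLatticeHomomorphism X.rawLattice X.refl
    ; ¬-homo                = λ x → X.refl
    ; D-homo                = λ x → X.refl
    ; ⊤-homo                = X.refl
    ; ⊥-homo                = X.refl
    ; c-homo                = X.refl
    }
    where module X = C3DPAlgebra X

  compose : {X Y Z : C3DPAlgebra a ℓ} →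
            C3DPHomomorphism Y Z → C3DPHomomorphism X Y → C3DPHomomorphism X Z
  compose {Z = Z} g f = record
    { ⟦_⟧                   = ⟦ g ⟧ ∘ ⟦ f ⟧
    ; isLatticeHomomorphism = LatticeComp.isLatticeHomomorphism Z.trans
                                (isLatticeHomomorphism f) (isLatticeHomomorphism g)
    ; ¬-homo                = λ x → Z.trans (⟦⟧-cong g (¬-homo f x)) (¬-homo g (⟦ f ⟧ x))
    ; D-homo                = λ x → Z.trans (⟦⟧-cong g (D-homo f x)) (D-homo g (⟦ f ⟧ x))
    ; ⊤-homo                = Z.trans (⟦⟧-cong g (⊤-homo f)) (⊤-homo g)
    ; ⊥-homo                = Z.trans (⟦⟧-cong g (⊥-homo f)) (⊥-homo g)
    ; c-homo                = Z.trans (⟦⟧-cong g (c-homo f)) (c-homo g)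
    }
    where module Z = C3DPAlgebra Z

{-# OPTIONS --safe #-}

-- A Boolean algebra B is sent to the algebra of intervals [l, h] with l ≤ h in B, where
-- ¬ [l, h] = [h′, h′], D [l, h] = [l′, l′] and the centre is [⊥, ⊤].  In the other
-- direction, a c3dp-algebra A is sent to its Boolean skeleton A / ker ¬.  The unit
-- a ↦ [DD a, ¬¬ a] is injective by regularity, and [l, h] is the image of
-- ¬¬ l ∨ (c ∧ ¬¬ h).

module Submission where

open import Defs
open import Level using (Level; suc; _⊔_)
open import Data.Product using (_×_; _,_; proj₁; proj₂)
open import Function.Definitions using (Injective; StrictlyInverseˡ)
open import Relation.Binary.Core using (Rel)
open import Algebra.Core using (Op₁; Op₂)
open import Algebra.Lattice.Bundles using (Lattice; DistributiveLattice; BooleanAlgebra)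
open import Algebra.Lattice.Structures using (IsDistributiveLattice; IsBooleanAlgebra)
open import Algebra.Lattice.Structures.Biased using (isBooleanAlgebraʳ)
open import Algebra.Lattice.Morphism.Structures using (IsLatticeHomomorphism; IsLatticeMonomorphism)
import Algebra.Lattice.Morphism.LatticeMonomorphism as LatticeMonomorphism
import Algebra.Lattice.Properties.Lattice as LatticeProperties
import Algebra.Lattice.Properties.DistributiveLattice as DistributiveLatticeProperties
import Algebra.Lattice.Properties.BooleanAlgebra as BooleanAlgebraProperties
import Relation.Binary.Lattice as OrderLattice
import Relation.Binary.Lattice.Properties.JoinSemilattice as JoinProperties
import Relation.Binary.Lattice.Properties.MeetSemilattice as MeetProperties
import Relation.Binary.Reasoning.Setoid as ≈-Reasoning
import Relation.Binary.Reasoning.PartialOrder as ≤-Reasoning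

private
  variable
    a b ℓ ℓ₁ ℓ₂ : Level

-- Stone algebras and their Boolean skeleton.

-- This isolates the axioms that `¬` satisfies in a c3dp-algebra and that `D` satisfies in its order
-- dual, so that each consequence is proved once and applied to both.
record StoneAlgebra (a ℓ : Level) : Set (suc (a ⊔ ℓ)) where
  infix  8 ¬_
  infixr 7 _∧_
  infixr 6 _∨_
  infix  4 _≈_
  field
    Carrier : Set a
    _≈_     : Rel Carrier ℓ
    _∨_ _∧_ : Op₂ Carrier
    ¬_      : Op₁ Carrier
    ⊤ ⊥     : Carrier
    isBoundedDistributiveLattice : IsBoundedDistributiveLattice _≈_ _∨_ _∧_ ⊤ ⊥
    ∧-¬        : ∀ x → x ∧ ¬ x ≈ ⊥
    ¬-greatest : ∀ x y → x ∧ y ≈ ⊥ → y ≈ y ∧ ¬ x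
    stone      : ∀ x → ¬ x ∨ ¬ ¬ x ≈ ⊤

  open IsBoundedDistributiveLattice isBoundedDistributiveLattice public

  lattice : Lattice a ℓ
  lattice = record { isLattice = isLattice }

  open Lattice lattice public using (setoid)

module StoneProperties (S : StoneAlgebra a ℓ) where

  open StoneAlgebra S
  open LatticeProperties lattice public using (poset)
  open LatticeProperties lattice using (∨-∧-orderTheoreticLattice)
  open OrderLattice.Lattice ∨-∧-orderTheoreticLattice public
    using (_≤_; antisym; x∧y≤x; x∧y≤y; ∧-greatest; x≤x∨y; y≤x∨y; ∨-least)
    renaming (refl to ≤-refl; reflexive to ≤-reflexive; trans to ≤-trans)
  open OrderLattice.Lattice ∨-∧-orderTheoreticLattice
    using (joinSemilattice; meetSemilattice)
  open JoinProperties joinSemilattice public using (∨-monotonic; x≤y⇒x∨y≈y)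
  open MeetProperties meetSemilattice public using (∧-monotonic; y≤x⇒x∧y≈y)
  open ≤-Reasoning poset

  ⊥-minimum : ∀ x → ⊥ ≤ x
  ⊥-minimum x = ≤-trans (x≤x∨y ⊥ x) (≤-reflexive (proj₁ ∨-identity x))

  ⊤-maximum : ∀ x → x ≤ ⊤
  ⊤-maximum x = sym (proj₂ ∧-identity x)

  ≤⊥⇒≈⊥ : ∀ {x} → x ≤ ⊥ → x ≈ ⊥
  ≤⊥⇒≈⊥ x≤⊥ = antisym x≤⊥ (⊥-minimum _)

  ⊤≤⇒≈⊤ : ∀ {x} → ⊤ ≤ x → x ≈ ⊤
  ⊤≤⇒≈⊤ ⊤≤x = antisym (⊤-maximum _) ⊤≤x

  disjoint⇒≤¬ : ∀ {x y} → x ∧ y ≤ ⊥ → y ≤ ¬ x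
  disjoint⇒≤¬ x∧y≤⊥ = ¬-greatest _ _ (≤⊥⇒≈⊥ x∧y≤⊥)

  ≤¬⇒disjoint : ∀ {x y} → y ≤ ¬ x → x ∧ y ≤ ⊥
  ≤¬⇒disjoint y≤¬x = ≤-trans (∧-monotonic ≤-refl y≤¬x) (≤-reflexive (∧-¬ _))

  ¬-antitone : ∀ {x y} → x ≤ y → ¬ y ≤ ¬ x
  ¬-antitone x≤y = disjoint⇒≤¬ (≤-trans (∧-monotonic x≤y ≤-refl) (≤-reflexive (∧-¬ _)))

  ¬-congruent : ∀ {x y} → x ≈ y → ¬ x ≈ ¬ y
  ¬-congruent x≈y = antisym (¬-antitone (≤-reflexive (sym x≈y))) (¬-antitone (≤-reflexive x≈y))

  x≤¬¬x : ∀ x → x ≤ ¬ ¬ x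
  x≤¬¬x x = disjoint⇒≤¬ (≤-reflexive (trans (∧-comm (¬ x) x) (∧-¬ x)))

  ¬¬¬x≈¬x : ∀ x → ¬ ¬ ¬ x ≈ ¬ x
  ¬¬¬x≈¬x x = antisym (¬-antitone (x≤¬¬x x)) (x≤¬¬x (¬ x))

  -- By distributivity, an inequality may be checked on each part of a cover of `⊤`. This replaces
  -- case analysis below.
  ≤-split : ∀ {x y u v} → u ∨ v ≈ ⊤ → x ∧ u ≤ y → x ∧ v ≤ y → x ≤ y
  ≤-split {x} {y} {u} {v} u∨v≈⊤ x∧u≤y x∧v≤y = begin
    x              ≈⟨ proj₂ ∧-identity x ⟨
    x ∧ ⊤          ≈⟨ ∧-congˡ u∨v≈⊤ ⟨
    x ∧ (u ∨ v)    ≈⟨ ∧-distribˡ-∨ x u v ⟩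
    x ∧ u ∨ x ∧ v  ≤⟨ ∨-least x∧u≤y x∧v≤y ⟩
    y              ∎

  complement-unique : ∀ {x y} → x ∧ y ≈ ⊥ → x ∨ y ≈ ⊤ → ¬ x ≈ y
  complement-unique {x} {y} x∧y≈⊥ x∨y≈⊤ = antisym
    (≤-split x∨y≈⊤ (≤-trans (≤-reflexive (trans (∧-comm (¬ x) x) (∧-¬ x))) (⊥-minimum y))
      (x∧y≤y (¬ x) y))
    (disjoint⇒≤¬ (≤-reflexive x∧y≈⊥))

  ¬⊤≈⊥ : ¬ ⊤ ≈ ⊥
  ¬⊤≈⊥ = complement-unique (proj₁ ∧-identity ⊥) (proj₂ ∨-identity ⊤)

  ¬⊥≈⊤ : ¬ ⊥ ≈ ⊤
  ¬⊥≈⊤ = complement-unique (proj₂ ∧-identity ⊥) (proj₁ ∨-identity ⊤)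

  ¬-∨ : ∀ x y → ¬ (x ∨ y) ≈ ¬ x ∧ ¬ y
  ¬-∨ x y = antisym
    (∧-greatest (¬-antitone (x≤x∨y x y)) (¬-antitone (y≤x∨y x y)))
    (disjoint⇒≤¬ (begin
      (x ∨ y) ∧ (¬ x ∧ ¬ y)                  ≈⟨ ∧-distribʳ-∨ _ x y ⟩
      x ∧ (¬ x ∧ ¬ y) ∨ y ∧ (¬ x ∧ ¬ y)      ≤⟨ ∨-least (≤¬⇒disjoint (x∧y≤x _ _))
                                                        (≤¬⇒disjoint (x∧y≤y _ _)) ⟩
      ⊥                                      ∎))

  -- The Stone identity enters here. The element `¬ (x ∧ y)` is split along `¬ y ∨ ¬ ¬ y`: the first
  -- part lies below `¬ y`, and the second is disjoint from `x`, because `x ∧ ¬ (x ∧ y)` lies below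
  -- `¬ y`.
  ¬-∧ : ∀ x y → ¬ (x ∧ y) ≈ ¬ x ∨ ¬ y
  ¬-∧ x y = antisym
    (≤-split (stone y)
      (≤-trans (x∧y≤y _ _) (y≤x∨y (¬ x) (¬ y)))
      (≤-trans (disjoint⇒≤¬ x-disjoint) (x≤x∨y (¬ x) (¬ y))))
    (∨-least (¬-antitone (x∧y≤x x y)) (¬-antitone (x∧y≤y x y)))
    where
    z = ¬ (x ∧ y)

    x∧z≤¬y : x ∧ z ≤ ¬ y
    x∧z≤¬y = disjoint⇒≤¬ (begin
      y ∧ (x ∧ z)  ≈⟨ ∧-assoc y x z ⟨
      (y ∧ x) ∧ z  ≈⟨ ∧-congʳ (∧-comm y x) ⟩
      (x ∧ y) ∧ z  ≈⟨ ∧-¬ (x ∧ y) ⟩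
      ⊥            ∎)

    x-disjoint : x ∧ (z ∧ ¬ ¬ y) ≤ ⊥
    x-disjoint = begin
      x ∧ (z ∧ ¬ ¬ y)  ≈⟨ ∧-assoc x z (¬ ¬ y) ⟨
      (x ∧ z) ∧ ¬ ¬ y  ≤⟨ ∧-monotonic x∧z≤¬y ≤-refl ⟩
      ¬ y ∧ ¬ ¬ y      ≈⟨ ∧-¬ (¬ y) ⟩
      ⊥                ∎

  ¬¬-∨ : ∀ x y → ¬ ¬ (x ∨ y) ≈ ¬ ¬ x ∨ ¬ ¬ y
  ¬¬-∨ x y = trans (¬-congruent (¬-∨ x y)) (¬-∧ (¬ x) (¬ y))

  ¬¬-∧ : ∀ x y → ¬ ¬ (x ∧ y) ≈ ¬ ¬ x ∧ ¬ ¬ y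
  ¬¬-∧ x y = trans (¬-congruent (¬-∧ x y)) (¬-∨ (¬ x) (¬ y))

  infix 4 _≈ₖ_
  -- The skeleton is a quotient on the same carrier, with `¬ ¬ x` as canonical member of the class
  -- of `x`. The subset of elements with `¬ ¬ x ≈ x` would carry proofs and leave `Set a`.
  _≈ₖ_ : Rel Carrier ℓ
  x ≈ₖ y = ¬ x ≈ ¬ y

  abstract
    -- The two de Morgan laws make `_≈ₖ_` a congruence, and the lattice identities are inherited.
    -- Excluded middle holds modulo the kernel because `¬ (x ∨ ¬ x)` is `¬ x ∧ ¬ ¬ x`.
    isBooleanAlgebra-ker¬ : IsBooleanAlgebra _≈ₖ_ _∨_ _∧_ ¬_ ⊤ ⊥
    isBooleanAlgebra-ker¬ = isBooleanAlgebraʳ (record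
      { isDistributiveLattice = record
        { isLattice = record
          { isEquivalence = record { refl = refl ; sym = sym ; trans = trans }
          ; ∨-comm        = λ x y → ¬-congruent (∨-comm x y)
          ; ∨-assoc       = λ x y z → ¬-congruent (∨-assoc x y z)
          ; ∨-cong        = λ p q → trans (¬-∨ _ _) (trans (∧-cong p q) (sym (¬-∨ _ _)))
          ; ∧-comm        = λ x y → ¬-congruent (∧-comm x y)
          ; ∧-assoc       = λ x y z → ¬-congruent (∧-assoc x y z)
          ; ∧-cong        = λ p q → trans (¬-∧ _ _) (trans (∨-cong p q) (sym (¬-∧ _ _)))
          ; absorptive    = (λ x y → ¬-congruent (∨-absorbs-∧ x y))
                          , (λ x y → ¬-congruent (∧-absorbs-∨ x y))
          }
        ; ∨-distrib-∧ = (λ x y z → ¬-congruent (∨-distribˡ-∧ x y z))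
                      , (λ x y z → ¬-congruent (∨-distribʳ-∧ x y z))
        ; ∧-distrib-∨ = (λ x y z → ¬-congruent (∧-distribˡ-∨ x y z))
                      , (λ x y z → ¬-congruent (∧-distribʳ-∨ x y z))
        }
      ; ∨-complementʳ = λ x → trans (¬-∨ x (¬ x)) (trans (∧-¬ (¬ x)) (sym ¬⊤≈⊥))
      ; ∧-complementʳ = λ x → ¬-congruent (∧-¬ x)
      ; ¬-cong        = ¬-congruent
      })

  booleanSkeleton : BooleanAlgebra a ℓ
  booleanSkeleton = record
    { _≈_ = _≈ₖ_
    ; _∨_ = _∨_
    ; _∧_ = _∧_
    ; ¬_  = ¬_
    ; ⊤   = ⊤
    ; ⊥   = ⊥
    ; isBooleanAlgebra = isBooleanAlgebra-ker¬
    }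

booleanStone : BooleanAlgebra a ℓ → StoneAlgebra a ℓ
booleanStone B = record
  { isBoundedDistributiveLattice = record
    { isDistributiveLattice = isDistributiveLattice
    ; ∨-identity            = ∨-identity
    ; ∧-identity            = ∧-identity
    }
  ; ∧-¬        = ∧-complementʳ
  ; ¬-greatest = λ x y x∧y≈⊥ → begin
      y                ≈⟨ ∧-identityʳ y ⟨
      y ∧ ⊤            ≈⟨ ∧-congˡ (∨-complementʳ x) ⟨
      y ∧ (x ∨ ¬ x)    ≈⟨ ∧-distribˡ-∨ y x (¬ x) ⟩
      y ∧ x ∨ y ∧ ¬ x  ≈⟨ ∨-congʳ (trans (∧-comm y x) x∧y≈⊥) ⟩
      ⊥ ∨ y ∧ ¬ x      ≈⟨ ∨-identityˡ (y ∧ ¬ x) ⟩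
      y ∧ ¬ x          ∎
  ; stone      = λ x → ∨-complementʳ (¬ x)
  }
  where
  open BooleanAlgebra B
  open BooleanAlgebraProperties B
  open ≈-Reasoning setoid

-- The c3dp-algebra of intervals of a Boolean algebra.

×-isDistributiveLattice : (L : DistributiveLattice a ℓ₁) (M : DistributiveLattice b ℓ₂) →
  let module L = DistributiveLattice L
      module M = DistributiveLattice M
  in IsDistributiveLattice
       (λ p q → (proj₁ p L.≈ proj₁ q) × (proj₂ p M.≈ proj₂ q))
       (λ p q → (proj₁ p L.∨ proj₁ q) , (proj₂ p M.∨ proj₂ q))
       (λ p q → (proj₁ p L.∧ proj₁ q) , (proj₂ p M.∧ proj₂ q))
×-isDistributiveLattice L M = record
  { isLattice = record
    { isEquivalence = record
      { refl  = L.refl , M.refl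
      ; sym   = λ (p , q) → L.sym p , M.sym q
      ; trans = λ (p , q) (p′ , q′) → L.trans p p′ , M.trans q q′
      }
    ; ∨-comm     = λ _ _ → L.∨-comm _ _ , M.∨-comm _ _
    ; ∨-assoc    = λ _ _ _ → L.∨-assoc _ _ _ , M.∨-assoc _ _ _
    ; ∨-cong     = λ (p , q) (p′ , q′) → L.∨-cong p p′ , M.∨-cong q q′
    ; ∧-comm     = λ _ _ → L.∧-comm _ _ , M.∧-comm _ _
    ; ∧-assoc    = λ _ _ _ → L.∧-assoc _ _ _ , M.∧-assoc _ _ _
    ; ∧-cong     = λ (p , q) (p′ , q′) → L.∧-cong p p′ , M.∧-cong q q′
    ; absorptive = (λ _ _ → L.∨-absorbs-∧ _ _ , M.∨-absorbs-∧ _ _)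
                 , (λ _ _ → L.∧-absorbs-∨ _ _ , M.∧-absorbs-∨ _ _)
    }
  ; ∨-distrib-∧ = (λ _ _ _ → L.∨-distribˡ-∧ _ _ _ , M.∨-distribˡ-∧ _ _ _)
                , (λ _ _ _ → L.∨-distribʳ-∧ _ _ _ , M.∨-distribʳ-∧ _ _ _)
  ; ∧-distrib-∨ = (λ _ _ _ → L.∧-distribˡ-∨ _ _ _ , M.∧-distribˡ-∨ _ _ _)
                , (λ _ _ _ → L.∧-distribʳ-∨ _ _ _ , M.∧-distribʳ-∨ _ _ _)
  }
  where
  module L = DistributiveLattice L
  module M = DistributiveLattice M

-- Pairs (l , h) with a proof of l ≤ h would live in Set (a ⊔ ℓ) instead of Set a.  So
-- an arbitrary pair (x , y) stands for the interval [x, x ∨ y], and pairs that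
-- represent the same interval are identified.
module Intervals (B : BooleanAlgebra a ℓ) where

  open BooleanAlgebra B
  open BooleanAlgebraProperties B
    using (∧-identityˡ; ∧-identityʳ; ∨-identityˡ; ∨-identityʳ)
  open StoneProperties (booleanStone B)

  Interval : Set _
  Interval = Carrier × Carrier

  lo hi : Interval → Carrier
  lo (x , y) = x
  hi (x , y) = x ∨ y

  lo≤hi : ∀ p → lo p ≤ hi p
  lo≤hi (x , y) = x≤x∨y x y

  hi-pair : ∀ {l h} → l ≤ h → hi (l , h) ≈ h
  hi-pair = x≤y⇒x∨y≈y

  infix 4 _≋_
  _≋_ : Rel Interval _
  p ≋ q = (lo p ≈ lo q) × (hi p ≈ hi q)

  -- The second component is already the intended upper end. It lies above the first, so `hi`
  -- returns it up to equality.
  join meet : Op₂ Interval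
  join p q = (lo p ∨ lo q) , (hi p ∨ hi q)
  meet p q = (lo p ∧ lo q) , (hi p ∧ hi q)

  point : Carrier → Interval
  point x = x , x

  hi-point : ∀ x → hi (point x) ≈ x
  hi-point x = hi-pair ≤-refl

  point-cong : ∀ {x y} → x ≈ y → point x ≋ point y
  point-cong x≈y = x≈y , ∨-cong x≈y x≈y

  neg dneg : Op₁ Interval
  neg p  = point (¬ hi p)
  dneg p = point (¬ lo p)

  hi-join : ∀ p q → hi (join p q) ≈ hi p ∨ hi q
  hi-join p q = hi-pair (∨-monotonic (lo≤hi p) (lo≤hi q))

  hi-meet : ∀ p q → hi (meet p q) ≈ hi p ∧ hi q
  hi-meet p q = hi-pair (∧-monotonic (lo≤hi p) (lo≤hi q))

  -- The pair of ends embeds intervals into the square of the Boolean algebra. It is injective by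
  -- the definition of `_≋_`, so the identities are pulled back from the product.
  isDistributiveLattice-≋ : IsDistributiveLattice _≋_ join meet
  isDistributiveLattice-≋ =
    LatticeMonomorphism.isDistributiveLattice bounds
      (×-isDistributiveLattice distributiveLattice distributiveLattice)
    where
    bounds : IsLatticeMonomorphism
      (record { _≈_ = _≋_ ; _∨_ = join ; _∧_ = meet })
      (record { _≈_ = λ p q → (proj₁ p ≈ proj₁ q) × (proj₂ p ≈ proj₂ q)
              ; _∨_ = λ p q → (proj₁ p ∨ proj₁ q) , (proj₂ p ∨ proj₂ q)
              ; _∧_ = λ p q → (proj₁ p ∧ proj₁ q) , (proj₂ p ∧ proj₂ q) })
      (λ p → lo p , hi p)
    bounds = record
      { isLatticeHomomorphism = record
        { isRelHomomorphism = record { cong = λ e → e }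
        ; ∧-homo            = λ p q → refl , hi-meet p q
        ; ∨-homo            = λ p q → refl , hi-join p q
        }
      ; injective = λ e → e
      }

  below : ∀ {p q} → lo p ≤ lo q → hi p ≤ hi q → p ≋ meet p q
  below {p} {q} l h = l , trans h (sym (hi-meet p q))

  below-point : ∀ {p x} → hi p ≤ x → p ≋ meet p (point x)
  below-point {p} {x} h = below (≤-trans (lo≤hi p) h) (≤-trans h (≤-reflexive (sym (hi-point x))))

  point-below : ∀ {p x} → x ≤ lo p → point x ≋ meet (point x) p
  point-below {p} {x} h = below h (≤-trans (≤-reflexive (hi-point x)) (≤-trans h (lo≤hi p)))

  -- Lower ends lie below upper ends, so the equation for the upper ends forces the other one.
  -- `join-one` is the dual.
  meet-zero : ∀ {p q} → hi p ∧ hi q ≈ ⊥ → meet p q ≋ point ⊥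
  meet-zero {p} {q} e =
      ≤⊥⇒≈⊥ (≤-trans (∧-monotonic (lo≤hi p) (lo≤hi q)) (≤-reflexive e))
    , trans (hi-meet p q) (trans e (sym (hi-point ⊥)))

  join-one : ∀ {p q} → lo p ∨ lo q ≈ ⊤ → join p q ≋ point ⊤
  join-one {p} {q} e =
      e
    , trans (hi-join p q) (trans hi≈⊤ (sym (hi-point ⊤)))
    where
    hi≈⊤ : hi p ∨ hi q ≈ ⊤
    hi≈⊤ = ⊤≤⇒≈⊤ (≤-trans (≤-reflexive (sym e)) (∨-monotonic (lo≤hi p) (lo≤hi q)))

  abstract
    isC3DPAlgebra-≋ : IsC3DPAlgebra _≋_ join meet neg dneg (point ⊤) (point ⊥) (⊥ , ⊤)
    isC3DPAlgebra-≋ = record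
      { isThreeValuedDPAlgebra = record
        { isRegularDPAlgebra = record
          { isDPAlgebra = record
            { isBoundedDistributiveLattice = record
              { isDistributiveLattice = isDistributiveLattice-≋
              ; ∨-identity =
                  (λ p → ∨-identityˡ (lo p)
                       , trans (hi-join (point ⊥) p)
                           (trans (∨-congʳ (hi-point ⊥)) (∨-identityˡ (hi p))))
                , (λ p → ∨-identityʳ (lo p)
                       , trans (hi-join p (point ⊥))
                           (trans (∨-congˡ (hi-point ⊥)) (∨-identityʳ (hi p))))
              ; ∧-identity =
                  (λ p → ∧-identityˡ (lo p)
                       , trans (hi-meet (point ⊤) p)
                           (trans (∧-congʳ (hi-point ⊤)) (∧-identityˡ (hi p))))
                , (λ p → ∧-identityʳ (lo p)
                       , trans (hi-meet p (point ⊤))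
                           (trans (∧-congˡ (hi-point ⊤)) (∧-identityʳ (hi p))))
              }
            ; ¬-cong     = λ (_ , h) → point-cong (¬-cong h)
            ; D-cong     = λ (l , _) → point-cong (¬-cong l)
            ; ¬-greatest = λ p →
                meet-zero (trans (∧-congˡ (hi-point _)) (∧-complementʳ (hi p)))
              , λ q (_ , h) → below-point (disjoint⇒≤¬ (≤-reflexive
                  (trans (sym (hi-meet p q)) (trans h (hi-point ⊥)))))
            ; D-least    = λ p →
                join-one (∨-complementʳ (lo p))
              , λ q (l , _) → point-below (≤-split l
                  (≤-trans (≤-reflexive (∧-complementˡ (lo p))) (⊥-minimum (lo q)))
                  (x∧y≤y _ (lo q)))
            }
          -- The left side has lower end `⊥` and the right side has upper end `⊤`, so both
          -- comparisons of ends are trivial.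
          ; regular = λ p q → below
              (≤-trans (≤-reflexive (∧-complementʳ (lo p))) (⊥-minimum _))
              (≤-trans (⊤-maximum _) (≤-reflexive (sym
                (trans (hi-join q (neg q)) (trans (∨-congˡ (hi-point _)) (∨-complementʳ (hi q)))))))
          }
        ; ¬-stone = λ p → join-one (trans (∨-congˡ (¬-cong (hi-point _))) (∨-complementʳ _))
        ; D-stone = λ p → meet-zero (trans (∧-cong (hi-point _) (hi-point _)) (∧-complementʳ _))
        }
      ; ¬-centre = point-cong (trans (¬-cong (hi-pair (⊥-minimum ⊤))) ¬⊤≈⊥)
      ; D-centre = point-cong ¬⊥≈⊤
      }

  algebra : C3DPAlgebra a ℓ
  algebra = record
    { Carrier = Interval
    ; _≈_     = _≋_
    ; _∨_     = join
    ; _∧_     = meet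
    ; ¬_      = neg
    ; D       = dneg
    ; ⊤       = point ⊤
    ; ⊥       = point ⊥
    ; c       = ⊥ , ⊤
    ; isC3DPAlgebra = isC3DPAlgebra-≋
    }

-- Interaction of `¬` and `D` in a c3dp-algebra.

module C3DPProperties (A : C3DPAlgebra a ℓ) where

  open C3DPAlgebra A

  stoneAlgebra : StoneAlgebra a ℓ
  stoneAlgebra = record
    { isBoundedDistributiveLattice = isBoundedDistributiveLattice
    ; ∧-¬        = λ x → proj₁ (¬-greatest x)
    ; ¬-greatest = λ x → proj₂ (¬-greatest x)
    ; stone      = ¬-stone
    }

  dualStoneAlgebra : StoneAlgebra a ℓ
  dualStoneAlgebra = record
    { isBoundedDistributiveLattice = record
      { isDistributiveLattice = ∧-∨-isDistributiveLattice
      ; ∨-identity            = ∧-identity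
      ; ∧-identity            = ∨-identity
      }
    ; ∧-¬        = λ x → proj₁ (D-least x)
    -- `D-least` states `D x ≤ y` through `∧`, while the dual order asks for `y ≈ y ∨ D x`.
    -- Absorption passes from one to the other.
    ; ¬-greatest = λ x y x∨y≈⊤ → begin
        y            ≈⟨ ∨-absorbs-∧ y (D x) ⟨
        y ∨ y ∧ D x  ≈⟨ ∨-congˡ (trans (∧-comm y (D x)) (sym (proj₂ (D-least x) y x∨y≈⊤))) ⟩
        y ∨ D x      ∎
    ; stone      = D-stone
    }
    where
    open DistributiveLatticeProperties distributiveLattice using (∧-∨-isDistributiveLattice)
    open ≈-Reasoning setoid

  open StoneProperties stoneAlgebra public
  -- Dualising exchanges `∨` with `∧` and `⊤` with `⊥`, which is why `¬¬-∨` becomes `DD-∧`. The dual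
  -- order unfolds to an equation with `∨`, hence the form of `x≈x∨DDx`.
  open StoneProperties dualStoneAlgebra public using () renaming
    ( ¬⊤≈⊥    to D⊥≈⊤
    ; ¬⊥≈⊤    to D⊤≈⊥
    ; x≤¬¬x   to x≈x∨DDx
    ; ¬¬¬x≈¬x to DDDx≈Dx
    ; ¬¬-∨    to DD-∧
    ; ¬¬-∧    to DD-∨
    ; complement-unique to D-complement-unique
    )

  DDx∨x≈x : ∀ x → D (D x) ∨ x ≈ x
  DDx∨x≈x x = trans (∨-comm _ x) (sym (x≈x∨DDx x))

  -- The Stone identity makes `¬ ¬ x` a complement of `¬ x`, and on a complemented element `D` gives
  -- the complement. `¬Dx≈DDx` follows in the same way from the identity for `D`.
  D¬x≈¬¬x : ∀ x → D (¬ x) ≈ ¬ ¬ x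
  D¬x≈¬¬x x = D-complement-unique (¬-stone x) (proj₁ (¬-greatest (¬ x)))

  DD¬x≈¬x : ∀ x → D (D (¬ x)) ≈ ¬ x
  DD¬x≈¬x x = trans (D-cong (D¬x≈¬¬x x)) (trans (D¬x≈¬¬x (¬ x)) (¬¬¬x≈¬x x))

  ¬Dx≈DDx : ∀ x → ¬ D x ≈ D (D x)
  ¬Dx≈DDx x = complement-unique (D-stone x) (proj₁ (D-least (D x)))

  ¬DDx≈Dx : ∀ x → ¬ D (D x) ≈ D x
  ¬DDx≈Dx x = trans (¬Dx≈DDx (D x)) (DDDx≈Dx x)

  DDc≈⊥ : D (D c) ≈ ⊥
  DDc≈⊥ = trans (D-cong D-centre) D⊤≈⊥

  -- Regularity is used here. The element `x` is split along `y ∨ D y`. Under `D y` it lies below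
  -- `x ∧ D x`, hence below `y ∨ ¬ y`, and its meet with `¬ y` vanishes because `¬ y ≤ ¬ x`.
  ≤-determined : ∀ {x y} → ¬ y ≤ ¬ x → D y ≤ D x → x ≤ y
  ≤-determined {x} {y} ¬y≤¬x Dy≤Dx =
    ≤-split (proj₁ (D-least y)) (x∧y≤y x y) (begin
      x ∧ D y                        ≤⟨ ∧-greatest (x∧y≤x x (D y)) x∧Dy≤y∨¬y ⟩
      x ∧ (y ∨ ¬ y)                  ≈⟨ ∧-distribˡ-∨ x y (¬ y) ⟩
      x ∧ y ∨ x ∧ ¬ y                ≤⟨ ∨-least (x∧y≤y x y)
                                          (≤-trans (≤¬⇒disjoint ¬y≤¬x) (⊥-minimum y)) ⟩
      y                              ∎)
    where
    open ≤-Reasoning poset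

    x∧Dy≤y∨¬y : x ∧ D y ≤ y ∨ ¬ y
    x∧Dy≤y∨¬y = ≤-trans (∧-monotonic ≤-refl Dy≤Dx) (regular x y)

  determined : ∀ {x y} → ¬ x ≈ ¬ y → D x ≈ D y → x ≈ y
  determined p q = antisym
    (≤-determined (≤-reflexive (sym p)) (≤-reflexive (sym q)))
    (≤-determined (≤-reflexive p) (≤-reflexive q))

-- The interval functor and the skeleton functor.

intervals : BooleanAlgebra a ℓ → C3DPAlgebra a ℓ
intervals = Intervals.algebra

skeleton : C3DPAlgebra a ℓ → BooleanAlgebra a ℓ
skeleton A = C3DPProperties.booleanSkeleton A

module IntervalMap {A B : BooleanAlgebra a ℓ} (f : BooleanHomomorphism A B) where

  private
    module IA = Intervals A
    module IB = Intervals B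
  open BooleanHomomorphism f
  open BooleanAlgebra B

  map : IA.Interval → IB.Interval
  map (x , y) = ⟦ x ⟧ , ⟦ y ⟧

  -- Preservation of `∨` lets a homomorphism act on representatives componentwise. The same equation
  -- is the naturality square of `hi-hom`.
  hi-map : ∀ p → IB.hi (map p) ≈ ⟦ IA.hi p ⟧
  hi-map (x , y) = sym (∨-homo x y)

  map-hom : C3DPHomomorphism (intervals A) (intervals B)
  map-hom = record
    { ⟦_⟧ = map
    ; isLatticeHomomorphism = record
      { isRelHomomorphism = record
        { cong = λ {p} {q} (l , h) →
            ⟦⟧-cong l , trans (hi-map p) (trans (⟦⟧-cong h) (sym (hi-map q))) }
      ; ∧-homo = λ p q → ∧-homo _ _ , (begin
          IB.hi (map (IA.meet p q))                ≈⟨ hi-map (IA.meet p q) ⟩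
          ⟦ IA.hi (IA.meet p q) ⟧                  ≈⟨ ⟦⟧-cong (IA.hi-meet p q) ⟩
          ⟦ BooleanAlgebra._∧_ A (IA.hi p) (IA.hi q) ⟧  ≈⟨ ∧-homo _ _ ⟩
          ⟦ IA.hi p ⟧ ∧ ⟦ IA.hi q ⟧                ≈⟨ ∧-cong (hi-map p) (hi-map q) ⟨
          IB.hi (map p) ∧ IB.hi (map q)            ≈⟨ IB.hi-meet (map p) (map q) ⟨
          IB.hi (IB.meet (map p) (map q))          ∎)
      ; ∨-homo = λ p q → ∨-homo _ _ , (begin
          IB.hi (map (IA.join p q))                ≈⟨ hi-map (IA.join p q) ⟩
          ⟦ IA.hi (IA.join p q) ⟧                  ≈⟨ ⟦⟧-cong (IA.hi-join p q) ⟩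
          ⟦ BooleanAlgebra._∨_ A (IA.hi p) (IA.hi q) ⟧  ≈⟨ ∨-homo _ _ ⟩
          ⟦ IA.hi p ⟧ ∨ ⟦ IA.hi q ⟧                ≈⟨ ∨-cong (hi-map p) (hi-map q) ⟨
          IB.hi (map p) ∨ IB.hi (map q)            ≈⟨ IB.hi-join (map p) (map q) ⟨
          IB.hi (IB.join (map p) (map q))          ∎)
      }
    ; ¬-homo = λ p → IB.point-cong (trans (¬-homo _) (¬-cong (sym (hi-map p))))
    ; D-homo = λ p → IB.point-cong (¬-homo _)
    ; ⊤-homo = IB.point-cong ⊤-homo
    ; ⊥-homo = IB.point-cong ⊥-homo
    ; c-homo = ⊥-homo , ∨-cong ⊥-homo ⊤-homo
    }
    where open ≈-Reasoning setoid

intervalsFunctor : ∀ a ℓ → Functor (BA a ℓ) (C3DP a ℓ)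
intervalsFunctor a ℓ = record
  { F₀           = intervals
  ; F₁           = IntervalMap.map-hom
  ; F-resp-≈     = λ {_} {Y} f≈g (x , y) → f≈g x , BooleanAlgebra.∨-cong Y (f≈g x) (f≈g y)
  ; identity     = λ {X} p → C3DPAlgebra.refl (intervals X)
  ; homomorphism = λ {_} {_} {Z} p → C3DPAlgebra.refl (intervals Z)
  }

-- The underlying map is unchanged. It respects the kernel of `¬` because it preserves `¬`.
skeleton-hom : {A B : C3DPAlgebra a ℓ} →
               C3DPHomomorphism A B → BooleanHomomorphism (skeleton A) (skeleton B)
skeleton-hom {B = B} f = record
  { ⟦_⟧ = ⟦_⟧
  ; isLatticeHomomorphism = record
    { isRelHomomorphism = record
      { cong = λ {x} {y} e → trans (sym (¬-homo x)) (trans (⟦⟧-cong e) (¬-homo y)) }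
    ; ∧-homo = λ x y → ¬-cong (∧-homo x y)
    ; ∨-homo = λ x y → ¬-cong (∨-homo x y)
    }
  ; ¬-homo = λ x → ¬-cong (¬-homo x)
  ; ⊤-homo = ¬-cong ⊤-homo
  ; ⊥-homo = ¬-cong ⊥-homo
  }
  where
  open C3DPHomomorphism f
  open C3DPAlgebra B

skeletonFunctor : ∀ a ℓ → Functor (C3DP a ℓ) (BA a ℓ)
skeletonFunctor a ℓ = record
  { F₀           = skeleton
  ; F₁           = skeleton-hom
  ; F-resp-≈     = λ {_} {Y} f≈g x → C3DPAlgebra.¬-cong Y (f≈g x)
  ; identity     = λ {X} x → C3DPAlgebra.refl X
  ; homomorphism = λ {_} {_} {Z} x → C3DPAlgebra.refl Z
  }

-- Right inverses of injective homomorphisms.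

module _ (L : Lattice a ℓ₁) (M : Lattice b ℓ₂) where

  private
    module L = Lattice L
    module M = Lattice M

  -- Each equation about `g` is checked after applying the injective `f`, where `f` cancels `g`.
  -- Thus only one direction of each isomorphism is verified by hand.
  section-isLatticeHomomorphism : ∀ {f g} → IsLatticeMonomorphism L.rawLattice M.rawLattice f →
    StrictlyInverseˡ M._≈_ f g → IsLatticeHomomorphism M.rawLattice L.rawLattice g
  section-isLatticeHomomorphism mono f∘g = record
    { isRelHomomorphism = record
      { cong = λ e → injective (M.trans (f∘g _) (M.trans e (M.sym (f∘g _)))) }
    ; ∧-homo = λ x y → injective (M.trans (f∘g _)
        (M.sym (M.trans (∧-homo _ _) (M.∧-cong (f∘g x) (f∘g y)))))
    ; ∨-homo = λ x y → injective (M.trans (f∘g _)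
        (M.sym (M.trans (∨-homo _ _) (M.∨-cong (f∘g x) (f∘g y)))))
    }
    where open IsLatticeMonomorphism mono

module _ (A B : BooleanAlgebra a ℓ) (f : BooleanHomomorphism A B) where

  private
    module A = BooleanAlgebra A
    module B = BooleanAlgebra B
  open BooleanHomomorphism f

  booleanSection : ∀ {g} → Injective A._≈_ B._≈_ ⟦_⟧ → StrictlyInverseˡ B._≈_ ⟦_⟧ g →
                   BooleanHomomorphism B A
  booleanSection {g} injective f∘g = record
    { ⟦_⟧ = g
    ; isLatticeHomomorphism = section-isLatticeHomomorphism A.lattice B.lattice
        (record { isLatticeHomomorphism = isLatticeHomomorphism ; injective = injective }) f∘g
    ; ¬-homo = λ x → injective (B.trans (f∘g _) (B.sym (B.trans (¬-homo _) (B.¬-cong (f∘g x)))))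
    ; ⊤-homo = injective (B.trans (f∘g _) (B.sym ⊤-homo))
    ; ⊥-homo = injective (B.trans (f∘g _) (B.sym ⊥-homo))
    }

module _ (A B : C3DPAlgebra a ℓ) (f : C3DPHomomorphism A B) where

  private
    module A = C3DPAlgebra A
    module B = C3DPAlgebra B
  open C3DPHomomorphism f

  c3dpSection : ∀ {g} → Injective A._≈_ B._≈_ ⟦_⟧ → StrictlyInverseˡ B._≈_ ⟦_⟧ g →
                C3DPHomomorphism B A
  c3dpSection {g} injective f∘g = record
    { ⟦_⟧ = g
    ; isLatticeHomomorphism = section-isLatticeHomomorphism A.lattice B.lattice
        (record { isLatticeHomomorphism = isLatticeHomomorphism ; injective = injective }) f∘g
    ; ¬-homo = λ x → injective (B.trans (f∘g _) (B.sym (B.trans (¬-homo _) (B.¬-cong (f∘g x)))))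
    ; D-homo = λ x → injective (B.trans (f∘g _) (B.sym (B.trans (D-homo _) (B.D-cong (f∘g x)))))
    ; ⊤-homo = injective (B.trans (f∘g _) (B.sym ⊤-homo))
    ; ⊥-homo = injective (B.trans (f∘g _) (B.sym ⊥-homo))
    ; c-homo = injective (B.trans (f∘g _) (B.sym c-homo))
    }

-- Components of the two natural isomorphisms.

module Skeleton∘Intervals (B : BooleanAlgebra a ℓ) where

  open BooleanAlgebra B
  open BooleanAlgebraProperties B using (¬-involutive)
  open Intervals B

  -- In the skeleton two intervals agree exactly when their `neg` agree, that is, when their upper
  -- ends do. The upper end is therefore a complete invariant.
  hi-hom : BooleanHomomorphism (skeleton (intervals B)) B
  hi-hom = record
    { ⟦_⟧ = hi
    ; isLatticeHomomorphism = record
      { isRelHomomorphism = record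
        { cong = λ (¬h , _) → trans (sym (¬-involutive _)) (trans (¬-cong ¬h) (¬-involutive _)) }
      ; ∧-homo = hi-meet
      ; ∨-homo = hi-join
      }
    ; ¬-homo = λ p → hi-point (¬ hi p)
    ; ⊤-homo = hi-point ⊤
    ; ⊥-homo = hi-point ⊥
    }

  hi-injective : ∀ {p q} → hi p ≈ hi q → neg p ≋ neg q
  hi-injective h = point-cong (¬-cong h)

  point-hom : BooleanHomomorphism B (skeleton (intervals B))
  point-hom = booleanSection (skeleton (intervals B)) B hi-hom hi-injective hi-point

module Intervals∘Skeleton (A : C3DPAlgebra a ℓ) where

  open C3DPAlgebra A
  open C3DPProperties A
  open Intervals (skeleton A) using (Interval; lo; hi; point; _≋_; hi-join; hi-meet)
  open ≈-Reasoning setoid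

  -- The upper end may be represented by a itself, since ¬¬ a and a agree in the skeleton.
  bounds : Carrier → Interval
  bounds a = D (D a) , a

  hi-bounds : ∀ x → hi (bounds x) ≈ x
  hi-bounds = DDx∨x≈x

  -- Ends are compared in the skeleton, so each equality of ends is an equation between values of
  -- `¬`. This explains the outer `¬-cong` here and below.
  bounds-cong : ∀ {x y} → x ≈ y → bounds x ≋ bounds y
  bounds-cong x≈y = ¬-cong DDx≈DDy , ¬-cong (∨-cong DDx≈DDy x≈y)
    where DDx≈DDy = D-cong (D-cong x≈y)

  bounds-point : ∀ {x y} → D (D x) ≈ y → x ≈ y → bounds x ≋ point y
  bounds-point {x} {y} DDx≈y x≈y =
    ¬-cong DDx≈y , ¬-cong (∨-cong DDx≈y x≈y)

  bounds-hom : C3DPHomomorphism A (intervals (skeleton A))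
  bounds-hom = record
    { ⟦_⟧ = bounds
    ; isLatticeHomomorphism = record
      { isRelHomomorphism = record { cong = bounds-cong }
      ; ∧-homo = λ x y → ¬-cong (DD-∧ x y)
          , trans (¬-cong (trans (hi-bounds _) (sym (∧-cong (hi-bounds x) (hi-bounds y)))))
                  (sym (hi-meet (bounds x) (bounds y)))
      ; ∨-homo = λ x y → ¬-cong (DD-∨ x y)
          , trans (¬-cong (trans (hi-bounds _) (sym (∨-cong (hi-bounds x) (hi-bounds y)))))
                  (sym (hi-join (bounds x) (bounds y)))
      }
    ; ¬-homo = λ x → let ¬x≈¬hi = ¬-cong (sym (hi-bounds x)) in
        bounds-point (trans (DD¬x≈¬x x) ¬x≈¬hi) ¬x≈¬hi
    ; D-homo = λ x → let Dx≈¬lo = sym (¬DDx≈Dx x) in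
        bounds-point (trans (DDDx≈Dx x) Dx≈¬lo) Dx≈¬lo
    ; ⊤-homo = bounds-point (trans (D-cong D⊤≈⊥) D⊥≈⊤) refl
    ; ⊥-homo = bounds-point (trans (D-cong D⊥≈⊤) D⊤≈⊥) refl
    ; c-homo = ¬-cong DDc≈⊥ , (begin
        ¬ hi (bounds c)  ≈⟨ ¬-cong (hi-bounds c) ⟩
        ¬ c              ≈⟨ ¬-centre ⟩
        ⊥                ≈⟨ ¬⊤≈⊥ ⟨
        ¬ ⊤              ≈⟨ ¬-cong (proj₁ ∨-identity ⊤) ⟨
        ¬ (⊥ ∨ ⊤)        ∎)
    }

  -- Equal upper ends mean `¬ x ≈ ¬ y`. Equal lower ends mean `D x ≈ D y`, since `¬ D (D x)` is
  -- `D x`. Regularity then applies through `determined`.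
  bounds-injective : ∀ {x y} → bounds x ≋ bounds y → x ≈ y
  bounds-injective {x} {y} (l , h) = determined
    (trans (¬-cong (sym (hi-bounds x))) (trans h (¬-cong (hi-bounds y))))
    (trans (sym (¬DDx≈Dx x)) (trans l (¬DDx≈Dx y)))

  -- The double negations pick canonical members of the skeleton classes. Since `¬ c` and `D (D c)`
  -- are both `⊥`, the term with `c` supplies the upper end and adds nothing to the lower one.
  element : Interval → Carrier
  element p = ¬ ¬ lo p ∨ c ∧ ¬ ¬ hi p

  DD-element : ∀ p → D (D (element p)) ≈ ¬ ¬ lo p
  DD-element p = begin
    D (D (¬ ¬ lo p ∨ c ∧ ¬ ¬ hi p))
      ≈⟨ DD-∨ _ _ ⟩
    D (D (¬ ¬ lo p)) ∨ D (D (c ∧ ¬ ¬ hi p))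
      ≈⟨ ∨-cong (DD¬x≈¬x _) (DD-∧ _ _) ⟩
    ¬ ¬ lo p ∨ D (D c) ∧ D (D (¬ ¬ hi p))
      ≈⟨ ∨-congˡ (≤⊥⇒≈⊥ (≤-trans (x∧y≤x _ _) (≤-reflexive DDc≈⊥))) ⟩
    ¬ ¬ lo p ∨ ⊥
      ≈⟨ proj₂ ∨-identity _ ⟩
    ¬ ¬ lo p
      ∎

  ¬-element : ∀ p → ¬ element p ≈ ¬ hi p
  ¬-element p = begin
    ¬ (¬ ¬ lo p ∨ c ∧ ¬ ¬ hi p)          ≈⟨ ¬-∨ _ _ ⟩
    ¬ ¬ ¬ lo p ∧ ¬ (c ∧ ¬ ¬ hi p)        ≈⟨ ∧-cong (¬¬¬x≈¬x _) (¬-∧ _ _) ⟩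
    ¬ lo p ∧ (¬ c ∨ ¬ ¬ ¬ hi p)          ≈⟨ ∧-congˡ (∨-cong ¬-centre (¬¬¬x≈¬x _)) ⟩
    ¬ lo p ∧ (⊥ ∨ ¬ hi p)                ≈⟨ ∧-congˡ (proj₁ ∨-identity _) ⟩
    ¬ lo p ∧ ¬ hi p                      ≈⟨ y≤x⇒x∧y≈y (¬-antitone (x≤x∨y _ _)) ⟩
    ¬ hi p                               ∎

  bounds-element : ∀ p → bounds (element p) ≋ p
  bounds-element p =
      trans (¬-cong (DD-element p)) (¬¬¬x≈¬x (lo p))
    , trans (¬-cong (hi-bounds (element p))) (¬-element p)

  element-hom : C3DPHomomorphism (intervals (skeleton A)) A
  element-hom = c3dpSection A (intervals (skeleton A)) bounds-hom bounds-injective bounds-element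

-- Naturality and the equivalence.

skeleton∘intervals≅id : ∀ a ℓ → skeletonFunctor a ℓ ∘F intervalsFunctor a ℓ ≅ idF
skeleton∘intervals≅id a ℓ = record
  { to      = hi-hom
  ; from    = point-hom
  ; natural = IntervalMap.hi-map
  ; to∘from = λ X → Intervals.hi-point X
  ; from∘to = λ X p → hi-injective X (Intervals.hi-point X (Intervals.hi X p))
  }
  where open Skeleton∘Intervals

intervals∘skeleton≅id : ∀ a ℓ → intervalsFunctor a ℓ ∘F skeletonFunctor a ℓ ≅ idF
intervals∘skeleton≅id a ℓ = record
  { to      = element-hom
  ; from    = bounds-hom
  -- `element` is a term in the operations and the constant `c`, so every homomorphism commutes with
  -- it.
  ; natural = λ {X} {Y} f p →
      let open C3DPHomomorphism f
          open C3DPAlgebra Y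
          ¬¬-homo : ∀ x → ⟦ C3DPAlgebra.¬_ X (C3DPAlgebra.¬_ X x) ⟧ ≈ ¬ ¬ ⟦ x ⟧
          ¬¬-homo x = trans (¬-homo _) (¬-cong (¬-homo x))
      in sym (trans (∨-homo _ _) (∨-cong (¬¬-homo _)
           (trans (∧-homo _ _) (∧-cong c-homo (trans (¬¬-homo _) (¬-cong (¬-cong (∨-homo _ _))))))))
  ; to∘from = λ X x → bounds-injective X (bounds-element X (bounds X x))
  ; from∘to = bounds-element
  }
  where open Intervals∘Skeleton

theorem4p5 : (a ℓ : Level) → Equivalence (BA a ℓ) (C3DP a ℓ)
theorem4p5 a ℓ = record
  { F    = intervalsFunctor a ℓ
  ; G    = skeletonFunctor a ℓ
  ; G∘F≅ = skeleton∘intervals≅id a ℓ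
  ; F∘G≅ = intervals∘skeleton≅id a ℓ
  }
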